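{- Let $n\geq 2$ and let $f=1^{x_{1}}0^{y_{1}}1^{x_{2}}0^{y_{2}}\cdots 1^{x_{n}}0^{y_{n}}$ with integers $x_i\geq 1$, $y_i\geq 1$ for $i=1,\ldots,n$. If $f$ is good, then, up to replacing $f$ by the complement of its reverse, $1^{y_{n}}0^{x_{n}}1^{y_{n-1}}0^{x_{n-1}}\cdots 1^{y_{1}}0^{x_{1}}$ (i.e. replacing $(x_1,y_1,\ldots,x_n,y_n)$ by $(y_n,x_n,\ldots,y_1,x_1)$), at least one of the following holds: (a) $x_{1}=1$ and $y_{n}=y_{1}+1$; (b) $x_{1}=x_{n}=1$ and $y_{1}=y_{n}$; (c) $x_{1}=1$, $x_{n}\geq 2$ and $y_{1}=y_{n}+1$; (d) $x_{1}=1$, $x_{n}=2$ and $y_{1}\geq y_{n}+2$.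
   Context: All strings are binary; $1^a$ (resp. $0^a$) denotes the string of $a$ consecutive ones (resp. zeros), and juxtaposition is concatenation. $Q_d$ is the $d$-dimensional hypercube: its vertices are the binary strings of length $d$, two being adjacent iff they differ in exactly one bit. A string $f$ is a factor of $\mu$ if $f$ appears as $|f|$ consecutive bits of $\mu$. The generalized Fibonacci cube $Q_d(f)$ is the subgraph of $Q_d$ induced by all strings of length $d$ that do not contain $f$ as a factor. A subgraph $H$ of a connected graph $G$ is an isometric subgraph, written $H\hookrightarrow G$, if $d_H(\mu,\nu)=d_G(\mu,\nu)$ for all $\mu,\nu\in V(H)$ (with $d_H=\infty$ for vertices in different components of $H$). A string $f$ is good if $Q_d(f)\hookrightarrow Q_d$ for all $d\geq 1$, and bad otherwise. (The reverse of $a_1a_2\cdots a_m$ is $a_m\cdots a_2a_1$; the complement replaces each bit $a$ by $1-a$. Goodness is invariant under reversal and complementation.) -}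

module Defs where

open import Data.Bool.Base using (Bool; true; false)
open import Data.Fin.Base using (Fin; zero; fromℕ)
open import Data.List.Base using (List; _++_; concat; replicate; tabulate)
open import Data.List.Relation.Binary.Infix.Heterogeneous using (Infix)
open import Data.Nat.Base using (ℕ; zero; suc; _+_; _≤_; _≥_)
open import Data.Product.Base using (_×_; _,_)
open import Data.Product using (∃!)
open import Data.Refinement.Base using (Refinement; value)
open import Data.Sum.Base using (_⊎_)
open import Data.Vec.Base using (Vec; lookup; toList)
open import Function.Base using (_∘_)
open import Function.Bundles using (_⇔_)
open import Relation.Binary.Core using (Rel)
open import Relation.Binary.Definitions using (Symmetric)
open import Relation.Binary.PropositionalEquality using (_≡_; _≢_; refl; ≢-sym)
open import Relation.Nullary.Negation.Core using (¬_)
open import Level using (0ℓ)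

record Graph : Set₁ where
  field
    Vertex     : Set
    Adjacent   : Rel Vertex 0ℓ
    symmetric  : Symmetric Adjacent
    loopless   : ∀ {u} → ¬ Adjacent u u

open Graph

data Walk (G : Graph) : Vertex G → Vertex G → ℕ → Set where
  []  : ∀ {u} → Walk G u u 0
  _∷_ : ∀ {u v w k} → Adjacent G u v → Walk G v w k → Walk G u w (suc k)

-- Distance as a relation: it holds for no k when u and v lie in different
-- components, which encodes distance ∞.
Distance : (G : Graph) → Vertex G → Vertex G → ℕ → Set
Distance G u v k = Walk G u v k × (∀ {l} → Walk G u v l → k ≤ l)

-- Membership proofs are irrelevant, so that a vertex of the induced subgraph
-- is determined by the underlying vertex of G.
induced : (G : Graph) → (Vertex G → Set) → Graph
induced G P = record
  { Vertex    = Refinement (Vertex G) P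
  ; Adjacent  = λ u v → Adjacent G (value u) (value v)
  ; symmetric = symmetric G
  ; loopless  = loopless G
  }

-- Equality of the two distances as elements of ℕ ∪ {∞}.
IsometricIn : (G : Graph) → (Vertex G → Set) → Set
IsometricIn G P =
  ∀ (u v : Vertex (induced G P)) (k : ℕ) →
  Distance (induced G P) u v k ⇔ Distance G (value u) (value v) k

hypercube : ℕ → Graph
hypercube d = record
  { Vertex    = Vec Bool d
  ; Adjacent  = λ u v → ∃! _≡_ (λ i → lookup u i ≢ lookup v i)
  ; symmetric = λ { (i , differ , unique) → i , ≢-sym differ , unique ∘ ≢-sym }
  ; loopless  = λ { (i , differ , _) → differ refl }
  }

_IsFactorOf_ : List Bool → List Bool → Set
_IsFactorOf_ = Infix _≡_

Avoids : List Bool → ∀ {d} → Vec Bool d → Set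
Avoids f μ = ¬ (f IsFactorOf toList μ)

-- The subgraph induced by Avoids f is the generalized Fibonacci cube Q_d(f).
Good : List Bool → Set
Good f = ∀ d → d ≥ 1 → IsometricIn (hypercube d) (Avoids f)

blocks : ∀ {n} → (Fin n → ℕ) → (Fin n → ℕ) → List Bool
blocks x y = concat (tabulate λ i → replicate (x i) true ++ replicate (y i) false)

Alternatives : ∀ {m} → (Fin (suc m) → ℕ) → (Fin (suc m) → ℕ) → Set
Alternatives {m} x y =
    (x₁ ≡ 1 × yₙ ≡ y₁ + 1)
  ⊎ (x₁ ≡ 1 × xₙ ≡ 1 × y₁ ≡ yₙ)
  ⊎ (x₁ ≡ 1 × xₙ ≥ 2 × y₁ ≡ yₙ + 1)
  ⊎ (x₁ ≡ 1 × xₙ ≡ 2 × y₁ ≥ yₙ + 2)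
  where
  x₁ xₙ y₁ yₙ : ℕ
  x₁ = x zero
  xₙ = x (fromℕ m)
  y₁ = y zero
  yₙ = y (fromℕ m)

{-# OPTIONS --safe #-}
-- Suppose that the prefix and the suffix of f of the same length ℓ differ in
-- exactly two bits i < j. Superpose two copies of f at distance s = length f ∸ ℓ,
-- which conflict in two bits, and flip one or the other of these: this gives two
-- words at distance 2 such that both words between them contain f. One of the two
-- always avoids f, and the other can contain f only if s = 2 (j ∸ i) and f has
-- period j ∸ i up to one error, so in all other cases f is not good. When none of
-- (a)–(d) holds, the two ends of f exhibit such a prefix and suffix.
module Submission where

open import Defs
open import Data.Nat.Base using (ℕ; _+_; _≥_; zero; suc; _∸_; _≤_; _<_; z≤n; s≤s; z<s; s<s; s<s⁻¹; s≤s⁻¹)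
open import Data.Fin.Base using (Fin; opposite; zero; suc; toℕ; fromℕ; fromℕ<; inject₁)
open import Data.Sum.Base using (_⊎_; inj₁; inj₂; [_,_]′)
open import Function.Base using (_∘_; case_of_)
open import Data.Bool.Base using (Bool; true; false; not)
open import Data.Bool.Properties as Bool using (not-involutive; not-¬; ¬-not)
open import Data.Empty using (⊥; ⊥-elim; ⊥-elim-irr)
open import Data.Fin.Properties using (toℕ-injective; toℕ-fromℕ<; opposite-involutive)
open import Data.Irrelevant using (Irrelevant; [_])
open import Data.List.Base using (List; []; _∷_; _++_; length; replicate)
open import Data.List.Properties using (length-++; length-replicate; ++-assoc; ++-identityʳ)
open import Data.List.Relation.Binary.Infix.Heterogeneous using (here; there)
open import Data.List.Relation.Binary.Infix.Heterogeneous.Properties using (infix?)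
open import Data.List.Relation.Binary.Prefix.Heterogeneous using (Prefix; []; _∷_)
open import Data.Nat.Properties
open import Data.Nat.Tactic.RingSolver using (solve-∀)
open import Data.Product.Base using (_×_; _,_; ∃; ∃-syntax; proj₁)
open import Data.Refinement.Base using (_,_)
open import Data.Vec.Base using (Vec; []; _∷_; lookup; toList; tabulate)
open import Data.Vec.Properties using (lookup∘tabulate)
open import Function.Bundles using (Equivalence)
open import Relation.Binary.Definitions using (tri<; tri≈; tri>)
open import Relation.Binary.PropositionalEquality
open import Relation.Nullary using (¬_; yes; no; contradiction)
open ≡-Reasoning

-- Words as bit functions, occurrences and near misses

-- Reads false beyond the end of the list.
nth : List Bool → ℕ → Bool
nth []       _       = false
nth (b ∷ _)  zero    = b
nth (_ ∷ bs) (suc m) = nth bs m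

Matches : (F : ℕ → Bool) (N : ℕ) (a : ℕ → Bool) (o : ℕ) → Set
Matches F N a o = ∀ {m} → m < N → a (o + m) ≡ F m

record NearMiss (F : ℕ → Bool) (N : ℕ) (a : ℕ → Bool) (o e : ℕ) : Set where
  field
    inside : e < N
    differ : a (o + e) ≢ F e
    agree  : ∀ {m} → m < N → m ≢ e → a (o + m) ≡ F m

prefix⇒matches : ∀ {f w} → Prefix _≡_ f w → Matches (nth f) (length f) (nth w) 0
prefix⇒matches (refl ∷ _) {zero}  _   = refl
prefix⇒matches (_ ∷ p)    {suc m} m<N = prefix⇒matches p (s<s⁻¹ m<N)

prefix⇒length≤ : ∀ {f w : List Bool} → Prefix _≡_ f w → length f ≤ length w
prefix⇒length≤ []      = z≤n
prefix⇒length≤ (_ ∷ p) = s≤s (prefix⇒length≤ p)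

factor⇒matches : ∀ {f w} → f IsFactorOf w →
  ∃[ o ] o + length f ≤ length w × Matches (nth f) (length f) (nth w) o
factor⇒matches (here p)  = 0 , prefix⇒length≤ p , prefix⇒matches p
factor⇒matches (there q) with factor⇒matches q
... | o , fits , match = suc o , s≤s fits , match

matches⇒prefix : ∀ f w → length f ≤ length w →
  Matches (nth f) (length f) (nth w) 0 → Prefix _≡_ f w
matches⇒prefix []      _       _    _     = []
matches⇒prefix (_ ∷ f) (_ ∷ w) fits match =
  sym (match z<s) ∷ matches⇒prefix f w (s≤s⁻¹ fits) (match ∘ s<s)

matches⇒factor : ∀ f w o → o + length f ≤ length w →
  Matches (nth f) (length f) (nth w) o → f IsFactorOf w
matches⇒factor f w       zero    fits match = here (matches⇒prefix f w fits match)
matches⇒factor f (_ ∷ w) (suc o) fits match =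
  there (matches⇒factor f w o (s≤s⁻¹ fits) match)

-- The bits of a at the four corners i, i + K, i + L, i + K + L (respectively
-- with j for i) are linked by four equations, an odd number of which fail
-- unless K + i ≡ j (respectively L + i ≡ j).
match-between-nearMisses : ∀ {F a N K L i j} → 1 ≤ K → 1 ≤ L → i ≢ j →
  (K + L) + j < N →
  NearMiss F N a 0 ((K + L) + i) → NearMiss F N a (K + L) j → Matches F N a K →
  K + i ≡ j × L + i ≡ j
match-between-nearMisses {F} {a} {N} {K} {L} {i} {j} 1≤K 1≤L i≢j s+j<N miss₁ miss₂ match
  = K+i≡j , L+i≡j
  where
  module M₁ = NearMiss miss₁
  module M₂ = NearMiss miss₂
  K+m<N : ∀ {m} → (K + L) + m < N → K + m < N
  K+m<N {m} = ≤-<-trans (+-monoˡ-≤ m (m≤m+n K L))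
  m<N : ∀ {m} → (K + L) + m < N → m < N
  m<N {m} = ≤-<-trans (m≤n+m m (K + L))
  K+m≢s+m : ∀ m → K + m ≢ (K + L) + m
  K+m≢s+m m = <⇒≢ (+-monoˡ-< m (m<m+n K 1≤L))
  shift : ∀ m → (K + L) + (K + m) ≡ K + ((K + L) + m)
  shift = rearrange K L
    where
    rearrange : ∀ K L m → (K + L) + (K + m) ≡ K + ((K + L) + m)
    rearrange = solve-∀
  K+i≡j : K + i ≡ j
  K+i≡j with K + i ≟ j
  ... | yes p = p
  -- The assumption `K + i ≢ j` enters once, where the second copy is read at `K + i`.
  ... | no K+i≢j = contradiction (begin
    a ((K + L) + i)       ≡⟨ M₂.agree (m<N M₁.inside) i≢j ⟩
    F i                   ≡⟨ match (m<N M₁.inside) ⟨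
    a (K + i)             ≡⟨ M₁.agree (K+m<N M₁.inside) (K+m≢s+m i) ⟩
    F (K + i)             ≡⟨ M₂.agree (K+m<N M₁.inside) K+i≢j ⟨
    a ((K + L) + (K + i)) ≡⟨ cong a (shift i) ⟩
    a (K + ((K + L) + i)) ≡⟨ match M₁.inside ⟩
    F ((K + L) + i)       ∎) M₁.differ
  L+i≡j : L + i ≡ j
  L+i≡j with L + i ≟ j
  ... | yes p = p
  -- The assumption `L + i ≢ j` enters once, where the first copy is read at `K + j`: its error
  -- `s + i` equals `K + j` only if `L + i ≡ j`.
  ... | no L+i≢j = contradiction (begin
    a ((K + L) + j)       ≡⟨ M₁.agree s+j<N (i≢j ∘ sym ∘ +-cancelˡ-≡ (K + L) j i) ⟩
    F ((K + L) + j)       ≡⟨ match s+j<N ⟨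
    a (K + ((K + L) + j)) ≡⟨ cong a (shift j) ⟨
    a ((K + L) + (K + j)) ≡⟨ M₂.agree (K+m<N s+j<N) (<⇒≢ (m<n+m j 1≤K) ∘ sym) ⟩
    F (K + j)             ≡⟨ M₁.agree (K+m<N s+j<N) (λ K+j≡s+i → L+i≢j (sym
                               (+-cancelˡ-≡ K j (L + i) (trans K+j≡s+i (+-assoc K L i))))) ⟨
    a (K + j)             ≡⟨ match (m<N s+j<N) ⟩
    F j                   ∎) M₂.differ

-- A bit has only two values, so changing the single wrong one makes it right.
nearMiss-repair : ∀ {F a b N o e} → NearMiss F N a o e → b (o + e) ≢ a (o + e) →
  (∀ {m} → m < N → m ≢ e → b (o + m) ≡ a (o + m)) → Matches F N b o
nearMiss-repair {e = e} miss differ agree {m} m<N with m ≟ e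
... | no m≢e = trans (agree m<N m≢e) (NearMiss.agree miss m<N m≢e)
... | yes refl = trans (¬-not differ) (sym (¬-not (NearMiss.differ miss ∘ sym)))

flip : ℕ → (ℕ → Bool) → ℕ → Bool
flip p a m with m ≟ p
... | yes _ = not (a m)
... | no _  = a m

flip-at : ∀ p a → flip p a p ≡ not (a p)
flip-at p a with p ≟ p
... | yes _ = refl
... | no p≢p = contradiction refl p≢p

flip-off : ∀ {p m} a → m ≢ p → flip p a m ≡ a m
flip-off {p} {m} a m≢p with m ≟ p
... | yes m≡p = contradiction m≡p m≢p
... | no _ = refl

-- Words as vertices of the hypercube

word : ∀ d → (ℕ → Bool) → Vec Bool d
word d a = tabulate (a ∘ toℕ)

bit : ∀ {d} → Vec Bool d → ℕ → Bool
bit v = nth (toList v)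

bit-toℕ : ∀ {d} (v : Vec Bool d) i → bit v (toℕ i) ≡ lookup v i
bit-toℕ (_ ∷ _) zero    = refl
bit-toℕ (_ ∷ v) (suc i) = bit-toℕ v i

bit-word : ∀ {d m} a → m < d → bit (word d a) m ≡ a m
bit-word {d} {m} a m<d = begin
  bit (word d a) m                  ≡⟨ cong (bit (word d a)) (toℕ-fromℕ< m<d) ⟨
  bit (word d a) (toℕ (fromℕ< m<d)) ≡⟨ bit-toℕ (word d a) (fromℕ< m<d) ⟩
  lookup (word d a) (fromℕ< m<d)    ≡⟨ lookup∘tabulate (a ∘ toℕ) (fromℕ< m<d) ⟩
  a (toℕ (fromℕ< m<d))              ≡⟨ cong a (toℕ-fromℕ< m<d) ⟩
  a m                               ∎

length-toList : ∀ {d} (v : Vec Bool d) → length (toList v) ≡ d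
length-toList []      = refl
length-toList (_ ∷ v) = cong suc (length-toList v)

word-adjacent : ∀ {d p} a b → p < d → a p ≢ b p → (∀ {m} → m ≢ p → a m ≡ b m) →
  Graph.Adjacent (hypercube d) (word d a) (word d b)
word-adjacent {d} {p} a b p<d differ agree =
  fromℕ< p<d , differ ∘ unword (toℕ-fromℕ< p<d) , unique
  where
  unword : ∀ {i q} → toℕ i ≡ q → lookup (word d a) i ≡ lookup (word d b) i → a q ≡ b q
  unword {i} refl eq =
    trans (sym (lookup∘tabulate (a ∘ toℕ) i)) (trans eq (lookup∘tabulate (b ∘ toℕ) i))
  unique : ∀ {i} → lookup (word d a) i ≢ lookup (word d b) i → fromℕ< p<d ≡ i
  unique {i} i-differ with toℕ i ≟ p
  ... | yes i≡p = toℕ-injective (trans (toℕ-fromℕ< p<d) (sym i≡p))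
  ... | no i≢p = contradiction
    (trans (lookup∘tabulate (a ∘ toℕ) i)
      (trans (agree i≢p) (sym (lookup∘tabulate (b ∘ toℕ) i)))) i-differ

-- Adjacency with natural numbers as positions, to fit the offsets of factors. A position beyond the
-- end cannot qualify, as both words read `false` there.
DiffersOnlyAt : ∀ {d} → Vec Bool d → Vec Bool d → ℕ → Set
DiffersOnlyAt {d} u v p = (bit u p ≢ bit v p) × (∀ {m} → m < d → m ≢ p → bit u m ≡ bit v m)

adjacent⇒ : ∀ {d} (u v : Vec Bool d) → Graph.Adjacent (hypercube d) u v →
  ∃ (DiffersOnlyAt u v)
adjacent⇒ {d} u v (i , differ , unique) =
  toℕ i , subst₂ _≢_ (sym (bit-toℕ u i)) (sym (bit-toℕ v i)) differ , agree
  where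
  agree : ∀ {m} → m < d → m ≢ toℕ i → bit u m ≡ bit v m
  agree {m} m<d m≢i with bit u m Bool.≟ bit v m
  ... | yes eq = eq
  ... | no neq = contradiction (sym (trans (cong toℕ (unique (neq ∘ same))) (toℕ-fromℕ< m<d))) m≢i
    where
    same : lookup u (fromℕ< m<d) ≡ lookup v (fromℕ< m<d) → bit u m ≡ bit v m
    same eq = subst (λ k → bit u k ≡ bit v k) (toℕ-fromℕ< m<d)
      (trans (bit-toℕ u (fromℕ< m<d)) (trans eq (sym (bit-toℕ v (fromℕ< m<d)))))

module _ {d} (u v : Vec Bool d) {p q : ℕ} (p<d : p < d) (q<d : q < d) (p≢q : p ≢ q)
         (differ-p : bit u p ≢ bit v p) (differ-q : bit u q ≢ bit v q) where

  length≥2 : ∀ {l} → Walk (hypercube d) u v l → 2 ≤ l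
  length≥2 []          = contradiction refl differ-p
  length≥2 (_ ∷ _ ∷ _) = s≤s (s≤s z≤n)
  length≥2 (e ∷ [])    with adjacent⇒ u v e
  ... | r , _ , agree with r ≟ p
  ... | yes refl = contradiction (agree q<d (p≢q ∘ sym)) differ-q
  ... | no r≢p = contradiction (agree p<d (r≢p ∘ sym)) differ-p

  -- A first step away from both `p` and `q` would leave two changes to the second step, which makes
  -- only one.
  middle-of-square : ∀ w → Graph.Adjacent (hypercube d) u w → Graph.Adjacent (hypercube d) w v →
    DiffersOnlyAt u w p ⊎ DiffersOnlyAt u w q
  middle-of-square w e₁ e₂ with adjacent⇒ u w e₁ | adjacent⇒ w v e₂
  ... | r , differ , agree | t , _ , agree′ with r ≟ p | r ≟ q | t ≟ p
  ... | yes refl | _ | _ = inj₁ (differ , agree)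
  ... | no _ | yes refl | _ = inj₂ (differ , agree)
  ... | no _ | no r≢q | yes refl = contradiction
    (trans (agree q<d (r≢q ∘ sym)) (agree′ q<d (p≢q ∘ sym))) differ-q
  ... | no r≢p | no _ | no t≢p = contradiction
    (trans (agree p<d (r≢p ∘ sym)) (agree′ p<d (t≢p ∘ sym))) differ-p

-- A geodesic of length 2 exists inside the subgraph, and its middle vertex belongs to the subgraph.
-- `Refinement` stores that membership irrelevantly, hence the form of the result.
isometric⇒middle : ∀ {G P} → IsometricIn G P → ∀ u v → P u → P v → Distance G u v 2 →
  ∃[ w ] Graph.Adjacent G u w × Graph.Adjacent G w v × Irrelevant (P w)
isometric⇒middle isometric u v Pu Pv distance
  with Equivalence.from (isometric (u , [ Pu ]) (v , [ Pv ]) 2) distance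
... | (_∷_ {v = w , Pw} e₁ (e₂ ∷ [])) , _ = w , e₁ , e₂ , Pw

-- Two superposed copies of a string

-- Equivalently, the prefix and the suffix of length `N ∸ s` differ exactly at `i` and `j`.
record TwoErrorPeriod (F : ℕ → Bool) (N s i j : ℕ) : Set where
  field
    insideᵢ : s + i < N
    insideⱼ : s + j < N
    distinct : i ≢ j
    differᵢ : F (s + i) ≢ F i
    differⱼ : F (s + j) ≢ F j
    agree   : ∀ {m} → s + m < N → m ≢ i → m ≢ j → F (s + m) ≡ F m

swap-errors : ∀ {F N s i j} → TwoErrorPeriod F N s i j → TwoErrorPeriod F N s j i
swap-errors per = record
  { insideᵢ = insideⱼ ; insideⱼ = insideᵢ ; distinct = distinct ∘ sym
  ; differᵢ = differⱼ ; differⱼ = differᵢ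
  ; agree = λ s+m<N m≢j m≢i → agree s+m<N m≢i m≢j }
  where open TwoErrorPeriod per

-- The exceptional case, in which a third copy of `F` can sit halfway between the two superposed
-- ones.
Symmetric : (F : ℕ → Bool) (N s i j : ℕ) → Set
Symmetric F N s i j =
  ∃[ K ] K + i ≡ j × s ≡ K + K × (∀ {m} → K + m < N → m ≢ j → F (K + m) ≡ F m)

-- F at offset 0 overrides a second copy of F at offset s.
glue : (F : ℕ → Bool) (N s : ℕ) → ℕ → Bool
glue F N s m with m <? N
... | yes _ = F m
... | no _  = F (m ∸ s)

module _ {F : ℕ → Bool} {N s i j : ℕ} (per : TwoErrorPeriod F N s i j) where
  open TwoErrorPeriod per

  private
    -- The glued word follows the first copy on the overlap. Flipping `s + i` spoils the first copy
    -- there and repairs the second, which is then wrong only at `j`.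
    α : ℕ → Bool
    α = flip (s + i) (glue F N s)

  glue-first : ∀ {m} → m < N → glue F N s m ≡ F m
  glue-first {m} m<N with m <? N
  ... | yes _ = refl
  ... | no m≮N = contradiction m<N m≮N

  glue-second : ∀ {m} → m ≢ i → m ≢ j → glue F N s (s + m) ≡ F m
  glue-second {m} m≢i m≢j with s + m <? N
  ... | yes s+m<N = agree s+m<N m≢i m≢j
  ... | no _ = cong F (m+n∸m≡n s m)

  nearMiss-first : NearMiss F N α 0 (s + i)
  nearMiss-first = record
    { inside = insideᵢ
    ; differ = λ eq → not-¬ refl (trans (sym eq)
                        (trans (flip-at (s + i) (glue F N s)) (cong not (glue-first insideᵢ))))
    ; agree  = λ m<N m≢s+i → trans (flip-off _ m≢s+i) (glue-first m<N) }

  α-errorⱼ : α (s + j) ≡ F (s + j)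
  α-errorⱼ = trans (flip-off _ (distinct ∘ sym ∘ +-cancelˡ-≡ s j i)) (glue-first insideⱼ)

  nearMiss-second : NearMiss F N α s j
  nearMiss-second = record
    { inside = ≤-<-trans (m≤n+m j s) insideⱼ
    ; differ = differⱼ ∘ trans (sym α-errorⱼ)
    ; agree  = λ _ → matches }
    where
    matches : ∀ {m} → m ≢ j → α (s + m) ≡ F m
    matches {m} m≢j with m ≟ i
    ... | yes refl = begin
      α (s + i)               ≡⟨ flip-at (s + i) (glue F N s) ⟩
      not (glue F N s (s + i)) ≡⟨ cong not (glue-first insideᵢ) ⟩
      not (F (s + i))         ≡⟨ ¬-not (differᵢ ∘ sym) ⟨
      F i                     ∎
    ... | no m≢i = trans (flip-off _ (m≢i ∘ +-cancelˡ-≡ s m i)) (glue-second m≢i m≢j)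

  -- Offsets `0` and `s` carry the near misses, so a match lies strictly between them. Its distances
  -- to both equal `j ∸ i`, which puts it in the middle.
  match⇒shift : ∀ {K} → K ≤ s → Matches F N α K →
    K + i ≡ j × s ≡ K + K
  match⇒shift {zero} _ match = contradiction (match insideᵢ) (NearMiss.differ nearMiss-first)
  match⇒shift {suc K} K≤s match with m≤n⇒∃[o]m+o≡n K≤s
  ... | zero , refl = contradiction
    (trans (cong (λ k → α (k + j)) (+-identityʳ (suc K))) (match (NearMiss.inside nearMiss-second)))
    (NearMiss.differ nearMiss-second)
  ... | suc L , refl with match-between-nearMisses z<s z<s distinct insideⱼ
                            nearMiss-first nearMiss-second match
  ... | K+i≡j , L+i≡j = K+i≡j , cong (suc K +_) (+-cancelʳ-≡ i (suc L) (suc K) (trans L+i≡j (sym K+i≡j)))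

  -- Below `N` the word `α` is `F` with the one bit `s + i`, that is `K + j`, flipped. A match at
  -- `K` therefore compares `F` with its own shift by `K`, except at `j`.
  match⇒Symmetric : ∀ {K} → K ≤ s → Matches F N α K → Symmetric F N s i j
  match⇒Symmetric {K} K≤s match with match⇒shift K≤s match
  ... | K+i≡j , s≡K+K = K , K+i≡j , s≡K+K , λ {m} K+m<N m≢j → begin
    F (K + m) ≡⟨ glue-first K+m<N ⟨
    glue F N s (K + m) ≡⟨ flip-off _ (λ K+m≡s+i → m≢j (+-cancelˡ-≡ K m j (K+m≡K+j K+m≡s+i))) ⟨
    α (K + m) ≡⟨ match (≤-<-trans (m≤n+m m K) K+m<N) ⟩
    F m ∎
    where
    K+m≡K+j : ∀ {m} → K + m ≡ s + i → K + m ≡ K + j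
    K+m≡K+j {m} K+m≡s+i = begin
      K + m       ≡⟨ K+m≡s+i ⟩
      s + i       ≡⟨ cong (_+ i) s≡K+K ⟩
      K + K + i   ≡⟨ +-assoc K K i ⟩
      K + (K + i) ≡⟨ cong (K +_) K+i≡j ⟩
      K + j       ∎

good⇒symmetric : ∀ {f s i j} → Good f → i < j →
  TwoErrorPeriod (nth f) (length f) s i j → Symmetric (nth f) (length f) s i j
good⇒symmetric {f} {s} {i} {j} good i<j per =
  let K , K≤s , match = factor⇒ α (u-contains ¬u-avoids) in match⇒Symmetric per K≤s match
  where
  open TwoErrorPeriod per
  F = nth f
  N = length f
  -- The copies at offsets `0` and `s` exactly fill the word, so every occurrence of `f` has an
  -- offset of at most `s`.
  d = s + N
  g = glue F N s
  α = flip (s + i) g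
  β = flip (s + j) g
  u = word d α
  v = word d β
  module Q = Graph (hypercube d)

  widen : ∀ {m} → m < N → m < d
  widen m<N = <-≤-trans m<N (m≤n+m N s)

  s+i≢s+j : s + i ≢ s + j
  s+i≢s+j = distinct ∘ +-cancelˡ-≡ s i j

  factor⇒ : ∀ a → f IsFactorOf toList (word d a) → ∃[ K ] K ≤ s × Matches F N a K
  factor⇒ a q with factor⇒matches q
  ... | K , fits , match = K , +-cancelʳ-≤ N K s K+N≤d ,
      λ m<N → trans (sym (bit-word a (<-≤-trans (+-monoʳ-< K m<N) K+N≤d))) (match m<N)
    where
    K+N≤d : K + N ≤ d
    K+N≤d = subst (K + N ≤_) (length-toList (word d a)) fits

  ⇒factor : ∀ o → o ≤ s → (w : Vec Bool d) → Matches F N (bit w) o → f IsFactorOf toList w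
  ⇒factor o o≤s w =
    matches⇒factor f (toList w) o (subst (o + N ≤_) (sym (length-toList w)) (+-monoˡ-≤ N o≤s))

  -- With `i` and `j` exchanged, an occurrence would give `K + j ≡ i`, against `i < j`.
  v-avoids : Avoids f v
  v-avoids q with factor⇒ β q
  ... | K , K≤s , match = <⇒≱ i<j
    (subst (j ≤_) (proj₁ (match⇒shift (swap-errors per) K≤s match)) (m≤n+m j K))

  u≢v-at : ∀ {m} → m < N → α m ≢ β m → bit u m ≢ bit v m
  u≢v-at m<N = subst₂ _≢_ (sym (bit-word α (widen m<N))) (sym (bit-word β (widen m<N)))

  u≢v-at-i : bit u (s + i) ≢ bit v (s + i)
  u≢v-at-i = u≢v-at insideᵢ λ eq → not-¬ refl
    (trans (sym (flip-off g s+i≢s+j)) (trans (sym eq) (flip-at (s + i) g)))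

  u≢v-at-j : bit u (s + j) ≢ bit v (s + j)
  u≢v-at-j = u≢v-at insideⱼ λ eq → not-¬ refl
    (trans (sym (flip-off g (s+i≢s+j ∘ sym))) (trans eq (flip-at (s + j) g)))

  distance-2 : Distance (hypercube d) u v 2
  distance-2 = (_∷_ {v = word d g} step₁ (step₂ ∷ [])) ,
    length≥2 u v (widen insideᵢ) (widen insideⱼ) s+i≢s+j u≢v-at-i u≢v-at-j
    where
    step₁ : Q.Adjacent u (word d g)
    step₁ = word-adjacent α g (widen insideᵢ) (λ eq → not-¬ refl (trans (sym eq) (flip-at (s + i) g)))
              (flip-off g)
    step₂ : Q.Adjacent (word d g) v
    step₂ = word-adjacent g β (widen insideⱼ) (λ eq → not-¬ refl (trans eq (flip-at (s + j) g)))
              (sym ∘ flip-off g)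
  repair : ∀ w {o e} → o ≤ s → NearMiss F N α o e → DiffersOnlyAt u w (o + e) →
    f IsFactorOf toList w
  repair w {o} {e} o≤s miss (differ , agree) = ⇒factor o o≤s w (nearMiss-repair {b = bit w} miss
      (λ eq → differ (trans (bit-word α (inside-d (NearMiss.inside miss))) (sym eq)))
      (λ {m} m<N m≢e → trans (sym (agree (inside-d m<N) (m≢e ∘ +-cancelˡ-≡ o m e)))
                             (bit-word α (inside-d m<N))))
    where
    inside-d : ∀ {m} → m < N → o + m < d
    inside-d m<N = +-mono-≤-< o≤s m<N

  -- In `u` the first copy is wrong only at `s + i` and the second only at `s + j`; the step to `w`
  -- corrects one of these.
  middle-contains : ∀ w → Q.Adjacent u w → Q.Adjacent w v → f IsFactorOf toList w
  middle-contains w e₁ e₂ = [ repair w z≤n (nearMiss-first per) , repair w ≤-refl (nearMiss-second per) ]′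
    (middle-of-square u v (widen insideᵢ) (widen insideⱼ) s+i≢s+j u≢v-at-i u≢v-at-j w e₁ e₂)

  -- Decidability of the factor relation recovers an actual occurrence, from which the shift `K` is
  -- read off.
  u-contains : ¬ Avoids f u → f IsFactorOf toList u
  u-contains ¬avoids with infix? Bool._≟_ f (toList u)
  ... | yes q = q
  ... | no avoids = contradiction avoids ¬avoids

  ¬u-avoids : ¬ Avoids f u
  ¬u-avoids u-avoids with isometric⇒middle (good d (≤-trans (s≤s z≤n) (widen insideᵢ))) u v
                            u-avoids v-avoids distance-2
  ... | w , e₁ , e₂ , [ w-avoids ] = ⊥-elim-irr (w-avoids (middle-contains w e₁ e₂))

-- Reverse complements and two-error overlaps

-- `G` is the complement of the reverse of `F`. Opposite positions are paired by an equation instead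
-- of truncated subtraction, which keeps the relation symmetric.
Mirror : (N : ℕ) (F G : ℕ → Bool) → Set
Mirror N F G = ∀ m m′ → suc (m + m′) ≡ N → G m ≡ not (F m′)

mirror-sym : ∀ {N F G} → Mirror N F G → Mirror N G F
mirror-sym {F = F} {G} mirror m m′ eq = begin
  F m             ≡⟨ not-involutive (F m) ⟨
  not (not (F m)) ≡⟨ cong not (mirror m′ m (trans (cong suc (+-comm m′ m)) eq)) ⟨
  not (G m′)      ∎

-- With G the mirror image of F, the prefix of F of length ℓ differs from its
-- suffix of length ℓ exactly at i and j. This form is symmetric in F and G.
record TwoErrorOverlap (F G : ℕ → Bool) (N ℓ i i′ j j′ : ℕ) : Set where
  field
    i+i′  : suc (i + i′) ≡ ℓ
    j+j′  : suc (j + j′) ≡ ℓ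
    i<j   : i < j
    ℓ≤N   : ℓ ≤ N
    -- The suffix of `F` reads `not (G i′)` at `i`, so an error is an equality here.
    errorᵢ : F i ≡ G i′
    errorⱼ : F j ≡ G j′
    agree : ∀ m m′ → suc (m + m′) ≡ ℓ → m ≢ i → m ≢ j → F m ≡ not (G m′)

-- Reversal exchanges prefix and suffix and the order of the errors, so `j′` comes first.
overlap-swap : ∀ {F G N ℓ i i′ j j′} →
  TwoErrorOverlap F G N ℓ i i′ j j′ → TwoErrorOverlap G F N ℓ j′ j i′ i
overlap-swap {F} {G} {ℓ = ℓ} {i} {i′} {j} {j′} ov = record
  { i+i′ = trans (cong suc (+-comm j′ j)) j+j′
  ; j+j′ = trans (cong suc (+-comm i′ i)) i+i′
  ; i<j = +-cancelˡ-< j j′ i′ (subst (_< j + i′) (suc-injective (trans i+i′ (sym j+j′)))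
            (+-monoˡ-< i′ i<j))
  ; ℓ≤N = ℓ≤N
  ; errorᵢ = sym errorⱼ
  ; errorⱼ = sym errorᵢ
  ; agree = λ m m′ eq m≢j′ m≢i′ → begin
      G m              ≡⟨ not-involutive (G m) ⟨
      not (not (G m))  ≡⟨ cong not (agree m′ m (trans (cong suc (+-comm m′ m)) eq)
                            (m≢i′ ∘ unique i+i′ eq) (m≢j′ ∘ unique j+j′ eq)) ⟨
      not (F m′)       ∎ }
  where
  open TwoErrorOverlap ov
  unique : ∀ {e e′ m m′} → suc (e + e′) ≡ ℓ → suc (m + m′) ≡ ℓ → m′ ≡ e → m ≡ e′
  unique {e} {e′} {m} e+e′ m+m′ refl =
    +-cancelˡ-≡ e m e′ (trans (+-comm e m) (suc-injective (trans m+m′ (sym e+e′))))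

-- The only consequence of goodness used from here on: every two-error overlap is of the exceptional
-- symmetric kind.
Rigid : (F G : ℕ → Bool) (N : ℕ) → Set
Rigid F G N = ∀ {ℓ i i′ j j′} → TwoErrorOverlap F G N ℓ i i′ j j′ →
  ∃[ s ] N ≡ s + ℓ × Symmetric F N s i j

good⇒rigid : ∀ {f G} → Mirror (length f) (nth f) G → Good f → Rigid (nth f) G (length f)
good⇒rigid {f} {G} mirror good {ℓ} {i} {i′} {j} {j′} ov =
  N ∸ ℓ , sym s+ℓ≡N , good⇒symmetric good i<j (record
    { insideᵢ = inside i+i′
    ; insideⱼ = inside j+j′
    ; distinct = <⇒≢ i<j
    ; differᵢ = differ i+i′ errorᵢ
    ; differⱼ = differ j+j′ errorⱼ
    ; agree = λ {m} s+m<N m≢i m≢j →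
        let k , m+1+k≡ℓ = m≤n⇒∃[o]m+o≡n (+-cancelˡ-< s m ℓ (subst (s + m <_) (sym s+ℓ≡N) s+m<N))
        in trans (opposite-bit m+1+k≡ℓ) (sym (agree m k m+1+k≡ℓ m≢i m≢j)) })
  where
  open TwoErrorOverlap ov
  N = length f
  s = N ∸ ℓ
  s+ℓ≡N : s + ℓ ≡ N
  s+ℓ≡N = m∸n+n≡m ℓ≤N
  inside : ∀ {e e′} → suc (e + e′) ≡ ℓ → s + e < N
  inside {e} {e′} eq = subst (s + e <_) s+ℓ≡N (+-monoʳ-< s (subst (e <_) eq (s≤s (m≤m+n e e′))))
  rearrange : ∀ e e′ s → suc (e′ + (s + e)) ≡ s + suc (e + e′)
  rearrange = solve-∀
  opposite-bit : ∀ {e e′} → suc (e + e′) ≡ ℓ → nth f (s + e) ≡ not (G e′)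
  opposite-bit {e} {e′} eq = begin
    nth f (s + e)             ≡⟨ not-involutive _ ⟨
    not (not (nth f (s + e))) ≡⟨ cong not (mirror e′ (s + e)
                                   (trans (rearrange e e′ s) (trans (cong (s +_) eq) s+ℓ≡N))) ⟨
    not (G e′)                ∎
  differ : ∀ {e e′} → suc (e + e′) ≡ ℓ → nth f e ≡ G e′ → nth f (s + e) ≢ nth f e
  differ eq error same = not-¬ refl (trans (sym error) (trans (sym same) (opposite-bit eq)))

-- A period survives reversal and complementation. The excepted pair `i′`, `K + i′` of `F` lands on
-- `K + j`, `j` in `G`, because `N` is `K + K + ℓ`.
rigid-swap : ∀ {F G N} → Mirror N F G → Rigid F G N → Rigid G F N
rigid-swap {F} {G} {N} mirror rigid {ℓ} {i} {i′} {j} {j′} ov with rigid (overlap-swap ov)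
... | s , N≡s+ℓ , K , K+j′≡i′ , s≡K+K , period = s , N≡s+ℓ , K , K+i≡j , s≡K+K , period′
  where
  open TwoErrorOverlap ov
  rearrange₁ : ∀ K i j′ → K + i + j′ ≡ i + (K + j′)
  rearrange₁ = solve-∀
  rearrange₂ : ∀ K m k → m + (K + k) ≡ K + m + k
  rearrange₂ = solve-∀
  rearrange₃ : ∀ K i′ m → K + i′ + m ≡ K + m + i′
  rearrange₃ = solve-∀
  rearrange₄ : ∀ K i i′ → K + K + suc (i + i′) ≡ suc (K + i′ + (K + i))
  rearrange₄ = solve-∀
  K+i≡j : K + i ≡ j
  K+i≡j = +-cancelʳ-≡ j′ (K + i) j (begin
    K + i + j′   ≡⟨ rearrange₁ K i j′ ⟩
    i + (K + j′) ≡⟨ cong (i +_) K+j′≡i′ ⟩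
    i + i′       ≡⟨ suc-injective (trans i+i′ (sym j+j′)) ⟩
    j + j′       ∎)
  period′ : ∀ {m} → K + m < N → m ≢ j → G (K + m) ≡ G m
  period′ {m} K+m<N m≢j with m≤n⇒∃[o]m+o≡n K+m<N
  ... | k , K+m+1+k≡N = begin
    G (K + m)     ≡⟨ mirror (K + m) k K+m+1+k≡N ⟩
    not (F k)     ≡⟨ cong not (period (subst (K + k <_) outer (s≤s (m≤n+m (K + k) m))) k≢i′) ⟨
    not (F (K + k)) ≡⟨ mirror m (K + k) outer ⟨
    G m           ∎
    where
    outer : suc (m + (K + k)) ≡ N
    outer = trans (cong suc (rearrange₂ K m k)) K+m+1+k≡N
    k≢i′ : k ≢ i′
    k≢i′ refl = m≢j (+-cancelˡ-≡ (K + i′) m j (suc-injective (begin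
      suc (K + i′ + m)         ≡⟨ cong suc (rearrange₃ K i′ m) ⟩
      suc (K + m + i′)         ≡⟨ K+m+1+k≡N ⟩
      N                        ≡⟨ N≡s+ℓ ⟩
      s + ℓ                    ≡⟨ cong₂ _+_ s≡K+K (sym i+i′) ⟩
      K + K + suc (i + i′)     ≡⟨ rearrange₄ K i i′ ⟩
      suc (K + i′ + (K + i))   ≡⟨ cong (λ e → suc (K + i′ + e)) K+i≡j ⟩
      suc (K + i′ + j)         ∎)))

-- Overlaps between the two ends

-- `F` begins with 1^a 0^b 1. For the mirror image, `Starts G yₙ xₙ` says that `F` ends with 0 1^xₙ
-- 0^yₙ.
record Starts (F : ℕ → Bool) (a b : ℕ) : Set where
  field
    ones  : ∀ {m} → m < a → F m ≡ true
    zeros : ∀ {m} → m < b → F (a + m) ≡ false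
    turn  : F (a + b) ≡ true

-- `Alternatives` unfolds to this type at the four outer exponents.
Alternative : (x₁ y₁ xₙ yₙ : ℕ) → Set
Alternative x₁ y₁ xₙ yₙ =
    (x₁ ≡ 1 × yₙ ≡ y₁ + 1)
  ⊎ (x₁ ≡ 1 × xₙ ≡ 1 × y₁ ≡ yₙ)
  ⊎ (x₁ ≡ 1 × xₙ ≥ 2 × y₁ ≡ yₙ + 1)
  ⊎ (x₁ ≡ 1 × xₙ ≡ 2 × y₁ ≥ yₙ + 2)

-- The prefix 11 and the suffix 00 differ in both bits. The exception would need `K ≡ 1` and so
-- `N ≡ 4`, but the first and last blocks already have six bits.
¬both≥2 : ∀ {F G N x₁ y₁ xₙ yₙ} → Rigid F G N → Starts F x₁ y₁ → Starts G yₙ xₙ →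
  1 ≤ y₁ → 1 ≤ xₙ → (x₁ + y₁) + (yₙ + xₙ) ≤ N → 2 ≤ x₁ → 2 ≤ yₙ → ⊥
¬both≥2 {F} {G} {N} rigid F-starts G-starts 1≤y₁ 1≤xₙ size 2≤x₁ 2≤yₙ = N≢4 (rigid ends)
  where
  module F = Starts F-starts
  module G = Starts G-starts
  6≤N : 6 ≤ N
  6≤N = ≤-trans (+-mono-≤ (+-mono-≤ 2≤x₁ 1≤y₁) (+-mono-≤ 2≤yₙ 1≤xₙ)) size
  ends : TwoErrorOverlap F G N 2 0 1 1 0
  ends = record
    { i+i′ = refl ; j+j′ = refl ; i<j = s≤s z≤n ; ℓ≤N = ≤-trans (s≤s (s≤s z≤n)) 6≤N
    ; errorᵢ = trans (F.ones (≤-trans (s≤s z≤n) 2≤x₁)) (sym (G.ones 2≤yₙ))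
    ; errorⱼ = trans (F.ones 2≤x₁) (sym (G.ones (≤-trans (s≤s z≤n) 2≤yₙ)))
    ; agree = λ where
        0 _ _ m≢0 _ → contradiction refl m≢0
        1 _ _ _ m≢1 → contradiction refl m≢1
        (suc (suc _)) _ () }
  N≢4 : ¬ (∃[ s ] N ≡ s + 2 × Symmetric F N s 0 1)
  N≢4 (_ , N≡4 , 1 , refl , refl , _) = <⇒≢ (≤-trans (s≤s (s≤s (s≤s (s≤s (s≤s z≤n))))) 6≤N) (sym N≡4)

-- Strings with a single leading one

module _ {F G : ℕ → Bool} {N y₁ xₙ yₙ : ℕ} (mirror : Mirror N F G) (rigid : Rigid F G N)
         (F-starts : Starts F 1 y₁) (G-starts : Starts G yₙ xₙ)
         (1≤y₁ : 1 ≤ y₁) (1≤xₙ : 1 ≤ xₙ) (1≤yₙ : 1 ≤ yₙ)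
         (size : (1 + y₁) + (yₙ + xₙ) ≤ N) where
  private
    module F = Starts F-starts
    module G = Starts G-starts

    G-zero : ∀ m → m < xₙ → G (m + yₙ) ≡ false
    G-zero m m<xₙ = subst (λ k → G k ≡ false) (+-comm yₙ m) (G.zeros m<xₙ)

    front≤N : 1 + y₁ ≤ N
    front≤N = ≤-trans (m≤m+n (1 + y₁) (yₙ + xₙ)) size

    back≤N : yₙ + xₙ ≤ N
    back≤N = ≤-trans (m≤n+m (yₙ + xₙ) (1 + y₁)) size

  -- The shift K is at most y₁, so that F K ≡ false while F 0 ≡ true.
  no-close-errors : ∀ {ℓ i i′ j j′} → j ≤ y₁ + i → ¬ TwoErrorOverlap F G N ℓ i i′ j j′
  no-close-errors {i = i} j≤y₁+i ov with rigid ov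
  ... | _ , _ , zero , refl , _ , _ = <-irrefl refl (TwoErrorOverlap.i<j ov)
  ... | _ , _ , suc K , refl , _ , period = case trans (sym (F.zeros K<y₁)) (trans
      (cong (F ∘ suc) (sym (+-identityʳ K))) (trans (period inside λ ()) (F.ones (s≤s z≤n)))) of λ ()
    where
    K<y₁ : K < y₁
    K<y₁ = +-cancelʳ-≤ i (suc K) y₁ j≤y₁+i
    inside : suc K + 0 < N
    inside = subst (_< N) (sym (+-identityʳ (suc K))) (≤-trans (s≤s K<y₁) front≤N)

  -- The prefix 1 0^y₁ 1 lies against a suffix of zeros, so its two ones are the errors.
  overlap-long-tail : 2 + y₁ ≤ yₙ → TwoErrorOverlap F G N (2 + y₁) 0 (1 + y₁) (1 + y₁) 0
  overlap-long-tail long = record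
    { i+i′ = refl ; j+j′ = cong (2 +_) (+-identityʳ y₁) ; i<j = s≤s z≤n
    ; ℓ≤N = ≤-trans long (≤-trans (m≤m+n yₙ xₙ) back≤N)
    ; errorᵢ = trans (F.ones (s≤s z≤n)) (sym (G.ones long))
    ; errorⱼ = trans F.turn (sym (G.ones 1≤yₙ))
    ; agree = agree }
    where
    agree : ∀ m m′ → suc (m + m′) ≡ 2 + y₁ → m ≢ 0 → m ≢ 1 + y₁ → F m ≡ not (G m′)
    agree zero    _  _  m≢0 _   = contradiction refl m≢0
    agree (suc m) m′ eq _   m≢j = trans
      (F.zeros (≤∧≢⇒< (subst (m ≤_) m+m′≡y₁ (m≤m+n m m′)) (m≢j ∘ cong suc)))
      (sym (cong not (G.ones (≤-trans (s≤s (m≤n⇒m≤1+n (subst (m′ ≤_) m+m′≡y₁ (m≤n+m m′ m)))) long))))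
      where
      m+m′≡y₁ : m + m′ ≡ y₁
      m+m′≡y₁ = suc-injective (suc-injective eq)

  -- If rigidity allows the overlap of length 2 + y₁, then it forces
  -- F = 1 0^y₁ 1 0^(2 + 2 y₁), which also has one of length 3 + y₁.
  ¬long-tail : ¬ 2 + y₁ ≤ yₙ
  ¬long-tail long with rigid (overlap-long-tail long)
  ... | s , N≡s+ℓ , K , K+0≡1+y₁ , s≡K+K , period = ¬same-shift (rigid longer)
    where
    K≡1+y₁ : K ≡ 1 + y₁
    K≡1+y₁ = trans (sym (+-identityʳ K)) K+0≡1+y₁
    N≡ : N ≡ (1 + y₁) + (1 + y₁) + (2 + y₁)
    N≡ = trans N≡s+ℓ (cong (_+ (2 + y₁)) (trans s≡K+K (cong₂ _+_ K≡1+y₁ K≡1+y₁)))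
    repeat : ∀ {m} → m < y₁ → F ((1 + y₁) + suc m) ≡ false
    repeat {m} m<y₁ = trans (subst (λ k → F (k + suc m) ≡ F (suc m)) K≡1+y₁
        (period (subst₂ (λ k n → k + suc m < n) (sym K≡1+y₁) (sym N≡)
            (≤-<-trans (+-monoʳ-≤ (1 + y₁) (s≤s (<⇒≤ m<y₁))) (m<m+n _ (s≤s z≤n))))
          (<⇒≢ m<y₁ ∘ suc-injective)))
      (F.zeros m<y₁)
    F-2+y₁ : F (2 + y₁) ≡ false
    F-2+y₁ = subst (λ k → F k ≡ false) (+-comm (1 + y₁) 1) (repeat 1≤y₁)
    G-2+y₁ : G (2 + y₁) ≡ true
    G-2+y₁ with m≤n⇒∃[o]m+o≡n 1≤y₁
    -- With `N` equal to 3 y₁ + 4, the position opposite to `2 + y₁` is `(1 + y₁) + y₁`, the last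
    -- zero supplied by `repeat`.
    ... | k , 1+k≡y₁ = trans (mirror (2 + y₁) ((1 + y₁) + y₁) (trans (rearrange y₁) (sym N≡)))
        (cong not (subst (λ m → F ((1 + y₁) + m) ≡ false) 1+k≡y₁ (repeat (≤-reflexive 1+k≡y₁))))
      where
      rearrange : ∀ y → suc (2 + y + (1 + y + y)) ≡ (1 + y) + (1 + y) + (2 + y)
      rearrange = solve-∀
    G-ones : ∀ {m} → m ≤ 2 + y₁ → G m ≡ true
    G-ones {m} m≤ with m ≟ 2 + y₁
    ... | yes refl = G-2+y₁
    ... | no m≢ = G.ones (<-≤-trans (≤∧≢⇒< m≤ m≢) long)
    -- The prefix 1 0^y₁ 1 0 against a suffix of `3 + y₁` zeros: the errors are the same two ones.
    longer : TwoErrorOverlap F G N (3 + y₁) 0 (2 + y₁) (1 + y₁) 1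
    longer = record
      { i+i′ = refl ; j+j′ = cong (2 +_) (+-comm y₁ 1) ; i<j = s≤s z≤n
      ; ℓ≤N = subst (3 + y₁ ≤_) (sym N≡) (s≤s (m≤n+m (2 + y₁) (y₁ + (1 + y₁))))
      ; errorᵢ = trans (F.ones (s≤s z≤n)) (sym G-2+y₁)
      ; errorⱼ = trans F.turn (sym (G-ones (s≤s z≤n)))
      ; agree = agree }
      where
      agree : ∀ m m′ → suc (m + m′) ≡ 3 + y₁ → m ≢ 0 → m ≢ 1 + y₁ → F m ≡ not (G m′)
      agree m m′ eq m≢0 m≢j = trans (F-zero m eq m≢0 m≢j)
          (sym (cong not (G-ones (subst (m′ ≤_) (suc-injective eq) (m≤n+m m′ m)))))
        where
        F-zero : ∀ m → suc (m + m′) ≡ 3 + y₁ → m ≢ 0 → m ≢ 1 + y₁ → F m ≡ false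
        F-zero zero    _  m≢0 _   = contradiction refl m≢0
        F-zero (suc m) eq _   m≢j with m <? y₁ | m ≟ 1 + y₁
        ... | yes m<y₁ | _ = F.zeros m<y₁
        ... | no _ | yes refl = F-2+y₁
        ... | no m≮y₁ | no m≢ = contradiction (≤∧≢⇒< (≮⇒≥ m≮y₁) (m≢j ∘ cong suc ∘ sym))
            (≤⇒≯ (s≤s⁻¹ (≤∧≢⇒< (subst (m ≤_) (suc-injective (suc-injective eq)) (m≤m+n m m′)) m≢)))
    -- The same errors fix the same shift, so `N` would exceed twice this shift both by `2 + y₁` and
    -- by `3 + y₁`.
    ¬same-shift : ¬ (∃[ s′ ] N ≡ s′ + (3 + y₁) × Symmetric F N s′ 0 (1 + y₁))
    ¬same-shift (s′ , N≡s′+ℓ , K′ , K′+0≡1+y₁ , s′≡K′+K′ , _) =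
      1+n≢n (+-cancelˡ-≡ ((1 + y₁) + (1 + y₁)) (3 + y₁) (2 + y₁) (begin
        (1 + y₁) + (1 + y₁) + (3 + y₁) ≡⟨ cong (_+ (3 + y₁)) (cong₂ _+_ K′≡1+y₁ K′≡1+y₁) ⟨
        K′ + K′ + (3 + y₁)             ≡⟨ cong (_+ (3 + y₁)) s′≡K′+K′ ⟨
        s′ + (3 + y₁)                  ≡⟨ N≡s′+ℓ ⟨
        N                              ≡⟨ N≡ ⟩
        (1 + y₁) + (1 + y₁) + (2 + y₁) ∎))
      where
      K′≡1+y₁ : K′ ≡ 1 + y₁
      K′≡1+y₁ = trans (sym (+-identityʳ K′)) K′+0≡1+y₁

  -- The prefix 1 0^y₁ 1 against the suffix 1 1 0^y₁.
  overlap-equal-tails : yₙ ≡ y₁ → 2 ≤ xₙ → TwoErrorOverlap F G N (2 + y₁) 1 y₁ (1 + y₁) 0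
  overlap-equal-tails yₙ≡y₁ 2≤xₙ = record
    { i+i′ = refl ; j+j′ = cong (2 +_) (+-identityʳ y₁) ; i<j = s≤s 1≤y₁
    ; ℓ≤N = ≤-trans (subst (λ k → 2 + k ≤ yₙ + xₙ) yₙ≡y₁
              (≤-trans (≤-reflexive (+-comm 2 yₙ)) (+-monoʳ-≤ yₙ 2≤xₙ))) back≤N
    ; errorᵢ = trans (F.zeros 1≤y₁) (sym (G-zero′ 0 1≤xₙ))
    ; errorⱼ = trans F.turn (sym (G.ones 1≤yₙ))
    ; agree = agree }
    where
    G-zero′ : ∀ m → m < xₙ → G (m + y₁) ≡ false
    G-zero′ m = subst (λ k → m < xₙ → G (m + k) ≡ false) yₙ≡y₁ (G-zero m)
    agree : ∀ m m′ → suc (m + m′) ≡ 2 + y₁ → m ≢ 1 → m ≢ 1 + y₁ → F m ≡ not (G m′)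
    agree 0 m′ eq _ _ = trans (F.ones (s≤s z≤n))
      (sym (cong not (trans (cong G (suc-injective eq)) (G-zero′ 1 2≤xₙ))))
    agree 1 _ _ m≢1 _ = contradiction refl m≢1
    agree (suc (suc m)) m′ eq _ m≢j = trans
      (F.zeros (≤∧≢⇒< (subst (suc m ≤_) m+m′ (s≤s (m≤m+n m m′))) (m≢j ∘ cong suc)))
      (sym (cong not (G.ones (subst (m′ <_) (trans m+m′ (sym yₙ≡y₁)) (s≤s (m≤n+m m′ m))))))
      where
      m+m′ : suc (m + m′) ≡ y₁
      m+m′ = suc-injective (suc-injective eq)

  -- The final `yₙ` positions of the next two overlaps, where zeros of the first block face the last
  -- zeros. Before them the prefix has its leading one and `k` zeros.
  inner : ∀ k m m′ → k + yₙ ≤ y₁ → suc (m + m′) ≡ yₙ → F (suc (k + m)) ≡ not (G m′)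
  inner k m m′ short eq = trans
    (F.zeros (<-≤-trans (+-monoʳ-< k (subst (m <_) eq (s≤s (m≤m+n m m′)))) short))
    (sym (cong not (G.ones (subst (m′ <_) eq (s≤s (m≤n+m m′ m))))))

  -- The prefix 1 0 0^yₙ against the suffix 0 1 0^yₙ, whose first bit is the end of the preceding
  -- block.
  overlap-single-one : suc yₙ ≤ y₁ → xₙ ≡ 1 → TwoErrorOverlap F G N (2 + yₙ) 0 (1 + yₙ) 1 yₙ
  overlap-single-one short xₙ≡1 = record
    { i+i′ = refl ; j+j′ = refl ; i<j = s≤s z≤n ; ℓ≤N = ≤-trans (s≤s short) front≤N
    ; errorᵢ = trans (F.ones (s≤s z≤n))
        (sym (trans (cong G (trans (+-comm 1 yₙ) (cong (yₙ +_) (sym xₙ≡1)))) G.turn))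
    ; errorⱼ = trans (F.zeros 1≤y₁) (sym (G-zero 0 1≤xₙ))
    ; agree = λ where
        0 _ _ m≢0 _ → contradiction refl m≢0
        1 _ _ _ m≢1 → contradiction refl m≢1
        (suc (suc m)) m′ eq _ _ → inner 1 m m′ short (suc-injective (suc-injective eq)) }

  -- The prefix 1 0 0 0^yₙ against the suffix 1 1 1 0^yₙ.
  overlap-triple-one : 2 + yₙ ≤ y₁ → 3 ≤ xₙ → TwoErrorOverlap F G N (3 + yₙ) 1 (1 + yₙ) 2 yₙ
  overlap-triple-one short 3≤xₙ = record
    { i+i′ = refl ; j+j′ = refl ; i<j = s≤s (s≤s z≤n) ; ℓ≤N = ≤-trans (s≤s short) front≤N
    ; errorᵢ = trans (F.zeros 1≤y₁) (sym (G-zero 1 (≤-trans (s≤s (s≤s z≤n)) 3≤xₙ)))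
    ; errorⱼ = trans (F.zeros (≤-trans (s≤s (s≤s z≤n)) short)) (sym (G-zero 0 1≤xₙ))
    ; agree = λ where
        0 m′ eq _ _ → trans (F.ones (s≤s z≤n))
          (sym (cong not (trans (cong G (suc-injective eq)) (G-zero 2 3≤xₙ))))
        1 _ _ m≢1 _ → contradiction refl m≢1
        2 _ _ _ m≢2 → contradiction refl m≢2
        (suc (suc (suc m))) m′ eq _ _ →
          inner 2 m m′ short (suc-injective (suc-injective (suc-injective eq))) }

  -- Compare `yₙ` with `y₁`, then split on `xₙ`. Apart from the long tail, each combination outside
  -- the alternatives has an overlap with errors at most `y₁` apart.
  alternative : Alternative 1 y₁ xₙ yₙ
  alternative with <-cmp yₙ (suc y₁)
  ... | tri> _ _ long = contradiction long ¬long-tail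
  ... | tri≈ _ yₙ≡ _ = inj₁ (refl , trans yₙ≡ (+-comm 1 y₁))
  ... | tri< yₙ<1+y₁ _ _ with yₙ ≟ y₁ | xₙ ≟ 1
  ... | yes yₙ≡y₁ | yes xₙ≡1 = inj₂ (inj₁ (refl , xₙ≡1 , sym yₙ≡y₁))
  ... | yes yₙ≡y₁ | no xₙ≢1 = contradiction
    (overlap-equal-tails yₙ≡y₁ (≤∧≢⇒< 1≤xₙ (xₙ≢1 ∘ sym))) (no-close-errors (≤-reflexive (+-comm 1 y₁)))
  ... | no yₙ≢y₁ | yes xₙ≡1 = contradiction
    (overlap-single-one (≤∧≢⇒< (s≤s⁻¹ yₙ<1+y₁) yₙ≢y₁) xₙ≡1)
    (no-close-errors (≤-trans 1≤y₁ (m≤m+n y₁ 0)))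
  ... | no yₙ≢y₁ | no xₙ≢1 with suc yₙ ≟ y₁ | xₙ ≟ 2
  ... | yes 1+yₙ≡y₁ | _ =
    inj₂ (inj₂ (inj₁ (refl , ≤∧≢⇒< 1≤xₙ (xₙ≢1 ∘ sym) , trans (sym 1+yₙ≡y₁) (+-comm 1 yₙ))))
  ... | no 1+yₙ≢y₁ | yes xₙ≡2 = inj₂ (inj₂ (inj₂ (refl , xₙ≡2 , subst (_≤ y₁) (+-comm 2 yₙ) 2+yₙ≤y₁)))
    where
    2+yₙ≤y₁ : 2 + yₙ ≤ y₁
    2+yₙ≤y₁ = ≤∧≢⇒< (≤∧≢⇒< (s≤s⁻¹ yₙ<1+y₁) yₙ≢y₁) 1+yₙ≢y₁
  ... | no 1+yₙ≢y₁ | no xₙ≢2 = contradiction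
    (overlap-triple-one (≤∧≢⇒< (≤∧≢⇒< (s≤s⁻¹ yₙ<1+y₁) yₙ≢y₁) 1+yₙ≢y₁)
      (≤∧≢⇒< (≤∧≢⇒< 1≤xₙ (xₙ≢1 ∘ sym)) (xₙ≢2 ∘ sym)))
    (no-close-errors (≤-trans (s≤s 1≤y₁) (≤-reflexive (+-comm 1 y₁))))

-- One of `x₁`, `yₙ` must be 1. If it is `yₙ`, the argument runs with `F` and `G` exchanged, which
-- yields the alternatives for the reverse complement.
rigid⇒alternative : ∀ {F G N x₁ y₁ xₙ yₙ} → Mirror N F G → Rigid F G N →
  Starts F x₁ y₁ → Starts G yₙ xₙ → 1 ≤ x₁ → 1 ≤ y₁ → 1 ≤ xₙ → 1 ≤ yₙ →
  (x₁ + y₁) + (yₙ + xₙ) ≤ N →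
  Alternative x₁ y₁ xₙ yₙ ⊎ Alternative yₙ xₙ y₁ x₁
rigid⇒alternative {N = N} {x₁} {y₁} {xₙ} {yₙ} mirror rigid F-starts G-starts 1≤x₁ 1≤y₁ 1≤xₙ 1≤yₙ size
  with x₁ ≟ 1 | yₙ ≟ 1
... | yes refl | _ = inj₁ (alternative mirror rigid F-starts G-starts 1≤y₁ 1≤xₙ 1≤yₙ size)
... | no _ | yes refl = inj₂ (alternative (mirror-sym mirror) (rigid-swap mirror rigid)
        G-starts F-starts 1≤xₙ 1≤y₁ 1≤x₁ (subst (_≤ N) (+-comm (x₁ + y₁) (1 + xₙ)) size))
... | no x₁≢1 | no yₙ≢1 = ⊥-elim (¬both≥2 rigid F-starts G-starts 1≤y₁ 1≤xₙ size
        (≤∧≢⇒< 1≤x₁ (x₁≢1 ∘ sym)) (≤∧≢⇒< 1≤yₙ (yₙ≢1 ∘ sym)))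

-- Block strings and the conclusion

nth-replicate : ∀ {m n} b xs → m < n → nth (replicate n b ++ xs) m ≡ b
nth-replicate {zero}  {suc n} b xs _   = refl
nth-replicate {suc m} {suc n} b xs m<n = nth-replicate b xs (s<s⁻¹ m<n)

nth-++ : ∀ xs ys m → nth (xs ++ ys) (length xs + m) ≡ nth ys m
nth-++ []       ys m = refl
nth-++ (_ ∷ xs) ys m = nth-++ xs ys m

nth-after-replicate : ∀ n b xs m → nth (replicate n b ++ xs) (n + m) ≡ nth xs m
nth-after-replicate zero    b xs m = refl
nth-after-replicate (suc n) b xs m = nth-after-replicate n b xs m

starts-list : ∀ {f} a b r → f ≡ replicate a true ++ replicate b false ++ true ∷ r → Starts (nth f) a b
starts-list a b r refl = record
  { ones  = nth-replicate true _
  ; zeros = λ {m} m<b → trans (nth-after-replicate a true _ m) (nth-replicate false _ m<b)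
  ; turn  = trans (nth-after-replicate a true _ b)
      (trans (cong (nth (replicate b false ++ true ∷ r)) (sym (+-identityʳ b)))
             (nth-after-replicate b false (true ∷ r) 0)) }

length-block : ∀ a b → length (replicate a true ++ replicate b false) ≡ a + b
length-block a b = trans (length-++ (replicate a true))
  (cong₂ _+_ (length-replicate a) (length-replicate b))

starts-mirror : ∀ {f G} a b r → f ≡ r ++ false ∷ replicate a true ++ replicate b false →
  Mirror (length f) (nth f) G → Starts G b a
starts-mirror {f} {G} a b r refl mirror = record { ones = ones ; zeros = zeros ; turn = turn }
  where
  tail : List Bool
  tail = replicate a true ++ replicate b false
  length-f : length f ≡ length r + suc (a + b)
  length-f = trans (length-++ r) (cong (λ k → length r + suc k) (length-block a b))
  mirror′ : ∀ m k → m + k ≡ a + b → G m ≡ not (nth (false ∷ tail) k)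
  mirror′ m k eq = trans (mirror m (length r + k) (trans (rearrange m k (length r))
      (sym (trans length-f (cong (λ l → length r + suc l) (sym eq))))))
      (cong not (nth-++ r (false ∷ tail) k))
    where
    rearrange : ∀ m k q → suc (m + (q + k)) ≡ q + suc (m + k)
    rearrange = solve-∀
  ones : ∀ {m} → m < b → G m ≡ true
  ones {m} m<b with m≤n⇒∃[o]m+o≡n m<b
  ... | k , refl = trans (mirror′ m (suc a + k) (rearrange m k a))
      (cong not (trans (nth-after-replicate a true _ k)
        (trans (cong (λ l → nth l k) (sym (++-identityʳ (replicate b false))))
               (nth-replicate false [] (s≤s (m≤n+m k m))))))
    where
    rearrange : ∀ m k a → m + (suc a + k) ≡ a + (suc m + k)
    rearrange = solve-∀
  zeros : ∀ {m} → m < a → G (b + m) ≡ false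
  zeros {m} m<a with m≤n⇒∃[o]m+o≡n m<a
  ... | k , refl = trans (mirror′ (b + m) (suc k) (rearrange m k b))
      (cong not (nth-replicate true _ (s≤s (m≤n+m k m))))
    where
    rearrange : ∀ m k b → b + m + suc k ≡ suc m + k + b
    rearrange = solve-∀
  turn : G (b + a) ≡ true
  -- Offset `0` of the final segment is the `false` in front of the last block.
  turn = mirror′ (b + a) 0 (trans (+-identityʳ (b + a)) (+-comm b a))

blocks-begin : ∀ {n} (x y : Fin (suc n) → ℕ) → x zero ≥ 1 → ∃[ r ] blocks x y ≡ true ∷ r
blocks-begin x y x₀≥1 with x zero
blocks-begin x y (s≤s _) | suc _ = _ , refl

blocks-end : ∀ {n} (x y : Fin (suc n) → ℕ) → y (fromℕ n) ≥ 1 → ∃[ r ] blocks x y ≡ r ++ false ∷ []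
blocks-end {zero} x y yₙ≥1 with m≤n⇒∃[o]m+o≡n yₙ≥1
... | k , 1+k≡yₙ = replicate (x zero) true ++ replicate k false , (begin
  (replicate (x zero) true ++ replicate (y zero) false) ++ []     ≡⟨ ++-identityʳ _ ⟩
  replicate (x zero) true ++ replicate (y zero) false             ≡⟨ cong (λ l → replicate (x zero) true ++ replicate l false) 1+k≡yₙ ⟨
  replicate (x zero) true ++ replicate (suc k) false              ≡⟨ cong (replicate (x zero) true ++_) (replicate-∷ʳ k) ⟩
  replicate (x zero) true ++ replicate k false ++ false ∷ []      ≡⟨ ++-assoc (replicate (x zero) true) _ _ ⟨
  (replicate (x zero) true ++ replicate k false) ++ false ∷ []    ∎)
  where
  replicate-∷ʳ : ∀ k → replicate (suc k) false ≡ replicate k false ++ false ∷ []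
  replicate-∷ʳ zero    = refl
  replicate-∷ʳ (suc k) = cong (false ∷_) (replicate-∷ʳ k)
blocks-end {suc n} x y yₙ≥1 with blocks-end (x ∘ suc) (y ∘ suc) yₙ≥1
... | r , eq = first ++ r , trans (cong (first ++_) eq) (sym (++-assoc first r _))
  where
  first = replicate (x zero) true ++ replicate (y zero) false

blocks-last : ∀ {n} (x y : Fin (suc n) → ℕ) → blocks x y ≡
  blocks (x ∘ inject₁) (y ∘ inject₁) ++ replicate (x (fromℕ n)) true ++ replicate (y (fromℕ n)) false
blocks-last {zero}  x y = ++-identityʳ _
blocks-last {suc n} x y = trans (cong (first ++_) (blocks-last (x ∘ suc) (y ∘ suc)))
  (sym (++-assoc first _ _))
  where
  first = replicate (x zero) true ++ replicate (y zero) false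

length-blocks≥ : ∀ {n} (x y : Fin (suc n) → ℕ) → x zero + y zero ≤ length (blocks x y)
length-blocks≥ x y = subst₂ _≤_ (length-block (x zero) (y zero))
  (sym (length-++ first)) (m≤m+n (length first) _)
  where
  first = replicate (x zero) true ++ replicate (y zero) false

theorem1p1 : (m : ℕ) (x y : Fin (2 + m) → ℕ) →
    (∀ i → x i ≥ 1) → (∀ i → y i ≥ 1) →
    Good (blocks x y) →
    Alternatives x y ⊎ Alternatives (y ∘ opposite) (x ∘ opposite)
theorem1p1 m x y x≥1 y≥1 good =
  -- `opposite zero` computes to `last`, while `opposite last` equals `zero` only propositionally;
  -- hence the transport.
  subst (λ k → Alternatives x y ⊎ Alternative (y last) (x last) (y k) (x k)) (sym opposite-last)
    (rigid⇒alternative mirror (good⇒rigid mirror good) f-starts G-starts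
      (x≥1 zero) (y≥1 zero) (x≥1 last) (y≥1 last) size)
  where
  last : Fin (2 + m)
  last = fromℕ (suc m)
  opposite-last : opposite last ≡ zero
  opposite-last = opposite-involutive zero
  f = blocks x y
  N = length f
  front = blocks (x ∘ inject₁) (y ∘ inject₁)
  back = replicate (x last) true ++ replicate (y last) false
  G : ℕ → Bool
  G k = not (nth f (N ∸ suc k))
  mirror : Mirror N (nth f) G
  mirror k k′ eq = cong (not ∘ nth f) (trans (cong (_∸ suc k) (sym eq)) (m+n∸m≡n k k′))
  -- As there are at least two blocks, the second supplies the one after the first run of zeros, and
  -- the last but one supplies the zero before the last block.
  f-starts : Starts (nth f) (x zero) (y zero)
  f-starts with blocks-begin (x ∘ suc) (y ∘ suc) (x≥1 (suc zero))
  ... | r , eq = starts-list (x zero) (y zero) r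
    (trans (++-assoc (replicate (x zero) true) _ _)
      (cong (λ l → replicate (x zero) true ++ replicate (y zero) false ++ l) eq))
  G-starts : Starts G (y last) (x last)
  G-starts with blocks-end (x ∘ inject₁) (y ∘ inject₁) (y≥1 (inject₁ (fromℕ m)))
  ... | r , eq = starts-mirror (x last) (y last) r
    (trans (blocks-last x y) (trans (cong (_++ back) eq) (++-assoc r _ _))) mirror
  size : (x zero + y zero) + (y last + x last) ≤ N
  size = subst ((x zero + y zero) + (y last + x last) ≤_)
    (sym (trans (cong length (blocks-last x y)) (length-++ front)))
    (+-mono-≤ (length-blocks≥ (x ∘ inject₁) (y ∘ inject₁))
      (≤-reflexive (trans (+-comm (y last) (x last)) (sym (length-block (x last) (y last))))))
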